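{- Let $\theta,\delta$ be congruences of $\mathbf{L}_n$, each with more than one class, such that $\theta\vee\delta\ne\{0,\dots,n\}^2$ and $\mathrm{ext}(\theta)\cap\mathrm{ext}(\delta)=\{0,n\}$. Then $\mathsf{f}_{\theta\vee\delta}=\mathsf{f}_\theta\cdot\mathsf{f}_\delta$.
   Context: For an integer $n\ge 1$, the line $\mathbf{L}_n$ is the frame $\langle\{0,\dots,n\},R\rangle$ where $x\mathrel{R}y$ iff $|x-y|\le 1$. A congruence of $\mathbf{L}_n$ is an equivalence relation $\theta$ on $\{0,\dots,n\}$ such that whenever $x'\mathrel{\theta}x$ and $x\mathrel{R}y$ there is $y'$ with $x'\mathrel{R}y'$ and $y'\mathrel{\theta}y$; join = generated equivalence relation. The quotient of $\mathbf{L}_n$ by $\theta$ is isomorphic to a line; the step of $\theta$ is the number of classes minus one; $e$ is an extreme of $\theta$ if $e/\theta$ is an endpoint of the quotient line, $\mathrm{ext}(\theta)$ the set of extremes. A rest of $\theta$ is a pair $\langle r,r+1\rangle\in\theta$. For $\theta$ with more than one class, its frequency is $\mathsf{f}_\theta=(n-\#\text{rests of }\theta)/(\text{step of }\theta)$. -}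

module Defs where

open import Data.Nat using (ℕ; zero; suc; _≤_; _∸_; ∣_-_∣)
open import Data.Fin using (Fin; toℕ; inject₁; fromℕ) renaming (zero to fzero; suc to fsuc)
open import Data.Integer using (+_)
open import Data.Rational using (ℚ; 0ℚ; _/_)
open import Data.Product using (Σ; ∃; _×_)
open import Data.Sum using (_⊎_)
open import Relation.Binary.PropositionalEquality using (_≡_)
open import Relation.Binary.Core using (Rel)
open import Relation.Binary.Structures using (IsEquivalence)
open import Function.Bundles using (_⇔_)
open import Function.Definitions using (Injective; Surjective)
open import Level using (0ℓ)

Pt : ℕ → Set
Pt n = Fin (suc n)

L : (n : ℕ) → Rel (Pt n) 0ℓ
L n x y = ∣ toℕ x - toℕ y ∣ ≤ 1

record IsCongruence (n : ℕ) (θ : Rel (Pt n) 0ℓ) : Set where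
  field
    isEquivalence : IsEquivalence θ
    back : ∀ x′ x y → θ x′ x → L n x y → ∃ λ y′ → L n x′ y′ × θ y′ y

data Join {n : ℕ} (θ δ : Rel (Pt n) 0ℓ) : Rel (Pt n) 0ℓ where
  inl   : ∀ {x y} → θ x y → Join θ δ x y
  inr   : ∀ {x y} → δ x y → Join θ δ x y
  refl  : ∀ {x} → Join θ δ x x
  sym   : ∀ {x y} → Join θ δ x y → Join θ δ y x
  trans : ∀ {x y z} → Join θ δ x y → Join θ δ y z → Join θ δ x z

-- q : Pt n → Pt k is the quotient map of θ, exhibiting an isomorphism
-- between the quotient frame L_n/θ and the line L_k:
--  * q is surjective and its kernel is θ (so the classes of θ are
--    in bijection with {0,…,k} via q);
--  * two classes are related in the quotient frame (some members are
--    R-related) iff their images are related in L_k.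
record QuotientLine (n : ℕ) (θ : Rel (Pt n) 0ℓ) (k : ℕ) (q : Pt n → Pt k) : Set where
  field
    surjective : Surjective _≡_ _≡_ q
    kernel     : ∀ x y → θ x y ⇔ (q x ≡ q y)
    hom        : ∀ x y → L k (q x) (q y) ⇔ (∃ λ x′ → ∃ λ y′ → θ x x′ × θ y y′ × L n x′ y′)

Step : (n : ℕ) → Rel (Pt n) 0ℓ → ℕ → Set
Step n θ k = Σ (Pt n → Pt k) (QuotientLine n θ k)

Extreme : (n : ℕ) → Rel (Pt n) 0ℓ → Pt n → Set
Extreme n θ e = ∃ λ k → Σ (Pt n → Pt k) λ q →
  QuotientLine n θ k q × (q e ≡ fzero ⊎ q e ≡ fromℕ k)

-- θ has exactly r rests: the set {i < n | ⟨i,i+1⟩ ∈ θ} has r elements,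
-- witnessed by an injective enumeration g : Fin r → Fin n of it.
Rests : (n : ℕ) → Rel (Pt n) 0ℓ → ℕ → Set
Rests n θ r = Σ (Fin r → Fin n) λ g →
  Injective _≡_ _≡_ g × (∀ i → θ (inject₁ i) (fsuc i) ⇔ (∃ λ j → g j ≡ i))

-- Frequency (n − #rests) / step; only used for step ≥ 1
-- (the value at step 0 is an irrelevant convention).
freq : (n r k : ℕ) → ℚ
freq n r zero    = 0ℚ
freq n r (suc k) = (+ (n ∸ r)) / suc k

{-# OPTIONS --safe #-}
-- Unfold L_n along the quotient map q of a congruence of step k: between two consecutive
-- extremes q crosses the whole of {0,…,k} monotonically, so q is determined, up to the sign and
-- modulo 2k, by the number of non-rests passed so far.  The quotient map s of θ ∨ δ factors as
-- p ∘ q through that of θ and likewise through that of δ; let D and E be the numbers of moves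
-- which s makes during one traverse of θ and of δ, and C its total number of moves, so that
-- C = f_θ D = f_δ E.  A point is an extreme of θ (of δ) iff its number of moves of s is divisible
-- by D (by E), hence lcm(D,E) = C by the hypothesis on extremes.  Divisibility of the number of
-- moves by 2 gcd(D,E) is invariant under both θ and δ, hence under θ ∨ δ, which identifies 0 with
-- the point reached after two traverses of s; so gcd(D,E) is the step c of θ ∨ δ.
-- Therefore C² = f_θ f_δ D E = f_θ f_δ c C, that is C / c = f_θ f_δ.
module Submission where

open import Defs hiding (refl; sym; trans)
open import Data.Nat as ℕ using (ℕ; zero; suc; _+_; _∸_; _≤_; _<_; z≤n; s≤s; ∣_-_∣; >-nonZero)
open import Data.Nat.Properties
open import Data.Nat.Divisibility
open import Data.Nat.GCD using (gcd; gcd[m,n]∣m; gcd[m,n]∣n; gcd-greatest)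
open import Data.Nat.LCM using (lcm; m∣lcm[m,n]; n∣lcm[m,n]; lcm-least; gcd*lcm)
open import Data.Nat.Tactic.RingSolver using (solve-∀)
open import Data.Fin using (Fin; toℕ; fromℕ; fromℕ<) renaming (zero to fzero)
open import Data.Fin.Properties
  using (toℕ-fromℕ<; toℕ-fromℕ; toℕ-injective; toℕ-inject₁; toℕ<n; toℕ≤pred[n]; injective⇒≤)
import Data.Integer as ℤ
import Data.Integer.Properties as ℤₚ
open import Data.Rational using (_*_; _/_; toℚᵘ)
open import Data.Rational.Properties using (toℚᵘ-injective; toℚᵘ-homo-*; toℚᵘ-fromℚᵘ)
open import Data.Rational.Unnormalised as ℚᵘ using (mkℚᵘ; *≡*)
import Data.Rational.Unnormalised.Properties as ℚᵘₚ
open import Data.Product using (_×_; _,_; ∃; proj₁; proj₂)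
open import Data.Sum using (_⊎_; inj₁; inj₂)
open import Function.Base using (id; _∘_)
open import Function.Bundles using (_⇔_; mk⇔; Equivalence)
open import Function.Definitions using (Injective)
open import Level using (0ℓ)
open import Relation.Binary.Core using (Rel)
open import Relation.Binary.Structures using (IsEquivalence)
open import Relation.Nullary using (¬_; yes; no; contradiction)
open import Relation.Binary.PropositionalEquality
  using (_≡_; _≢_; refl; sym; trans; cong; cong₂; subst; subst₂; module ≡-Reasoning)

open Equivalence using (to; from)

-- Adjacency of natural numbers

Near : ℕ → ℕ → Set
Near x y = y ≡ x ⊎ y ≡ suc x ⊎ x ≡ suc y

near-sym : ∀ {x y} → Near x y → Near y x
near-sym (inj₁ e)        = inj₁ (sym e)
near-sym (inj₂ (inj₁ e)) = inj₂ (inj₂ e)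
near-sym (inj₂ (inj₂ e)) = inj₂ (inj₁ e)

near-suc : ∀ {x y} → Near x y → Near (suc x) (suc y)
near-suc (inj₁ e)        = inj₁ (cong suc e)
near-suc (inj₂ (inj₁ e)) = inj₂ (inj₁ (cong suc e))
near-suc (inj₂ (inj₂ e)) = inj₂ (inj₂ (cong suc e))

∣-∣≤1⇒near : ∀ x y → ∣ x - y ∣ ≤ 1 → Near x y
∣-∣≤1⇒near zero    zero          _ = inj₁ refl
∣-∣≤1⇒near zero    (suc zero)    _ = inj₂ (inj₁ refl)
∣-∣≤1⇒near zero    (suc (suc y)) (s≤s ())
∣-∣≤1⇒near (suc zero)    zero    _ = inj₂ (inj₂ refl)
∣-∣≤1⇒near (suc (suc x)) zero    (s≤s ())
∣-∣≤1⇒near (suc x) (suc y)       h = near-suc (∣-∣≤1⇒near x y h)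

∣n-1+n∣≡1 : ∀ n → ∣ n - suc n ∣ ≡ 1
∣n-1+n∣≡1 zero    = refl
∣n-1+n∣≡1 (suc n) = ∣n-1+n∣≡1 n

near⇒∣-∣≤1 : ∀ {x y} → Near x y → ∣ x - y ∣ ≤ 1
near⇒∣-∣≤1 {x} (inj₁ refl)            = ≤-trans (≤-reflexive (∣n-n∣≡0 x)) z≤n
near⇒∣-∣≤1 {x} (inj₂ (inj₁ refl))     = ≤-reflexive (∣n-1+n∣≡1 x)
near⇒∣-∣≤1 {_} {y} (inj₂ (inj₂ refl)) = ≤-reflexive (trans (∣-∣-comm (suc y) y) (∣n-1+n∣≡1 y))

near-∸ : ∀ {k x y} → x ≤ k → y ≤ k → Near x y → Near (k ∸ x) (k ∸ y)
near-∸ _ _ (inj₁ refl)               = inj₁ refl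
near-∸ {suc k} _ (s≤s x≤k) (inj₂ (inj₁ refl)) = inj₂ (inj₂ (+-∸-assoc 1 x≤k))
near-∸ {suc k} (s≤s y≤k) _ (inj₂ (inj₂ refl)) = inj₂ (inj₁ (+-∸-assoc 1 y≤k))

-- Two distinct neighbours would lie on opposite sides of `t`, but nothing is below 0 and the bounds
-- exclude `suc a`.
near-endpoint-unique : ∀ {a t u v} → u ≤ a → v ≤ a → t ≡ 0 ⊎ t ≡ a →
  Near t u → u ≢ t → Near t v → v ≢ t → u ≡ v
near-endpoint-unique _ _ _ (inj₁ u≡t) u≢t _ _ = contradiction u≡t u≢t
near-endpoint-unique _ _ _ _ _ (inj₁ v≡t) v≢t = contradiction v≡t v≢t
near-endpoint-unique _ _ _ (inj₂ (inj₁ refl)) _ (inj₂ (inj₁ refl)) _ = refl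
near-endpoint-unique _ _ _ (inj₂ (inj₂ e)) _ (inj₂ (inj₂ e′)) _ = suc-injective (trans (sym e) e′)
near-endpoint-unique _ _ (inj₁ refl) (inj₂ (inj₁ _)) _ (inj₂ (inj₂ ())) _
near-endpoint-unique _ _ (inj₁ refl) (inj₂ (inj₂ ())) _ (inj₂ (inj₁ _)) _
near-endpoint-unique u≤a _ (inj₂ refl) (inj₂ (inj₁ refl)) _ _ _ = contradiction u≤a 1+n≰n
near-endpoint-unique _ v≤a (inj₂ refl) _ _ (inj₂ (inj₁ refl)) _ = contradiction v≤a 1+n≰n

≢0⇒suc : ∀ {m} → m ≢ 0 → ∃ λ t → m ≡ suc t
≢0⇒suc {zero}  m≢0 = contradiction refl m≢0
≢0⇒suc {suc t} _   = t , refl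

-- Total variation of sequences

-- For a fold, whose values change by at most 1, this counts the non-rests before `x`.
variation : (ℕ → ℕ) → ℕ → ℕ
variation f zero    = 0
variation f (suc x) = ∣ f x - f (suc x) ∣ + variation f x

variation-id : ∀ x → variation id x ≡ x
variation-id zero    = refl
variation-id (suc x) = cong₂ _+_ (∣n-1+n∣≡1 x) (variation-id x)

variation-cong : ∀ {f g} x → (∀ {y} → y ≤ x → f y ≡ g y) → variation f x ≡ variation g x
variation-cong zero    h = refl
variation-cong (suc x) h = cong₂ _+_ (cong₂ ∣_-_∣ (h (n≤1+n x)) (h ≤-refl))
  (variation-cong x (λ y≤x → h (m≤n⇒m≤1+n y≤x)))

variation-mono : ∀ f {x y} → x ≤ y → variation f x ≤ variation f y
variation-mono f {y = y} x≤y with m≤n⇒m<n∨m≡n x≤y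
... | inj₂ refl = ≤-refl
variation-mono f {y = suc y} x≤y | inj₁ (s≤s x≤y′) =
  ≤-trans (variation-mono f x≤y′) (m≤n+m _ _)

variation-suc-< : ∀ f x → f x ≢ f (suc x) → variation f x < variation f (suc x)
variation-suc-< f x ne with ∣ f x - f (suc x) ∣ in eq
... | zero  = contradiction (∣m-n∣≡0⇒m≡n eq) ne
... | suc d = s≤s (m≤n+m _ d)

∣-∣≤variation : ∀ f x → ∣ f 0 - f x ∣ ≤ variation f x
∣-∣≤variation f zero    = ≤-reflexive (∣n-n∣≡0 (f 0))
∣-∣≤variation f (suc x) = begin
  ∣ f 0 - f (suc x) ∣                     ≤⟨ ∣-∣-triangle (f 0) (f x) (f (suc x)) ⟩
  ∣ f 0 - f x ∣ + ∣ f x - f (suc x) ∣     ≤⟨ +-monoˡ-≤ _ (∣-∣≤variation f x) ⟩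
  variation f x + ∣ f x - f (suc x) ∣     ≡⟨ +-comm (variation f x) _ ⟩
  variation f (suc x)                     ∎
  where open ≤-Reasoning

-- Discrete intermediate value theorem: the last `x` below `n` with `h x ≤ v` steps from exactly `v`
-- to `suc v`, as no step rises by more than 1.
climb : ∀ (h : ℕ → ℕ) n → h 0 ≡ 0 → (∀ {x} → x < n → h (suc x) ≤ suc (h x)) →
  ∀ {v} → v < h n → ∃ λ x → x < n × h x ≡ v × h (suc x) ≡ suc v
climb h zero    h0 _ v< = contradiction (subst (_ <_) h0 v<) λ ()
climb h (suc n) h0 h≤ {v} v< with v <? h n
... | yes v<hn = let x , x<n , e , e′ = climb h n h0 (λ x<n → h≤ (m<n⇒m<1+n x<n)) v<hn
                 in x , m<n⇒m<1+n x<n , e , e′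
... | no v≮hn = n , ≤-refl , ≤-antisym hn≤v v≤hn , ≤-antisym (≤-trans (h≤ ≤-refl) (s≤s hn≤v)) v<
  where
  hn≤v = ≮⇒≥ v≮hn
  v≤hn = ℕ.s≤s⁻¹ (≤-trans v< (h≤ ≤-refl))

-- Folds of a line onto a line

-- Surjective bounded morphisms between lines, on natural numbers with the values beyond `n` left
-- free; `step` is the forth and `lift` the back condition.
record Fold (n k : ℕ) (q : ℕ → ℕ) : Set where
  field
    bounded : ∀ {x} → x ≤ n → q x ≤ k
    step    : ∀ {x} → x < n → Near (q x) (q (suc x))
    lift    : ∀ {x u} → x ≤ n → u ≤ k → Near (q x) u → ∃ λ y → y ≤ n × Near x y × q y ≡ u
    onto    : ∀ {t} → t ≤ k → ∃ λ x → x ≤ n × q x ≡ t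

  near : ∀ {x y} → x ≤ n → y ≤ n → Near x y → Near (q x) (q y)
  near _ _   (inj₁ refl)            = inj₁ refl
  near _ y≤n (inj₂ (inj₁ refl))     = step y≤n
  near x≤n _ (inj₂ (inj₂ refl))     = near-sym (step x≤n)

  variation-attains : ∀ {v} → v ≤ variation q n → ∃ λ x → x ≤ n × variation q x ≡ v
  variation-attains v≤ with m≤n⇒m<n∨m≡n v≤
  ... | inj₂ refl = n , ≤-refl , refl
  ... | inj₁ v<   = let x , x<n , e , _ = climb (variation q) n refl
                          (λ x<n → +-monoˡ-≤ _ (near⇒∣-∣≤1 (step x<n))) v<
                    in x , <⇒≤ x<n , e

id-fold : ∀ {n} → Fold n n id
id-fold = record
  { bounded = id
  ; step    = λ _ → inj₂ (inj₁ refl)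
  ; lift    = λ _ u≤n near → _ , u≤n , near , refl
  ; onto    = λ t≤n → _ , t≤n , refl
  }

-- An interior value of s needs neighbours with three distinct values, hence so does q.
endpoint-factor : ∀ {n a c q s} → Fold n a q → Fold n c s →
  (∀ {x y} → x ≤ n → y ≤ n → q x ≡ q y → s x ≡ s y) →
  ∀ {x} → x ≤ n → q x ≡ 0 ⊎ q x ≡ a → s x ≡ 0 ⊎ s x ≡ c
endpoint-factor {n} {a} {c} {q} {s} F J factor {x} x≤n end with s x in sx | s x ≟ c
... | zero  | _         = inj₁ refl
... | suc v | yes sx≡c = inj₂ sx≡c
... | suc v | no sx≢c = contradiction (factor y≤n z≤n′ qy≡qz) sy≢sz
  where
  module F = Fold F
  module J = Fold J
  v<c : suc v < c
  v<c = ≤∧≢⇒< (subst (_≤ c) sx (J.bounded x≤n)) sx≢c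
  below = J.lift {x} {v} x≤n (<⇒≤ (<-trans ≤-refl v<c)) (inj₂ (inj₂ sx))
  above = J.lift {x} {suc (suc v)} x≤n v<c (inj₂ (inj₁ (cong suc (sym sx))))
  y = proj₁ below
  z = proj₁ above
  y≤n = proj₁ (proj₂ below)
  z≤n′ = proj₁ (proj₂ above)
  sy : s y ≡ v
  sy = proj₂ (proj₂ (proj₂ below))
  sz : s z ≡ suc (suc v)
  sz = proj₂ (proj₂ (proj₂ above))
  sy≢sz : s y ≢ s z
  sy≢sz e = contradiction (trans (trans (sym sy) e) sz) (λ e → m≢1+n+m v {1} e)
  qy≡qz : q y ≡ q z
  qy≡qz = near-endpoint-unique (F.bounded y≤n) (F.bounded z≤n′) end
    (F.near x≤n y≤n (proj₁ (proj₂ (proj₂ below))))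
    (λ e → contradiction (trans (sym sy) (trans (factor y≤n x≤n e) sx)) (λ e → m≢1+n+m v {0} e))
    (F.near x≤n z≤n′ (proj₁ (proj₂ (proj₂ above))))
    (λ e → contradiction (trans (sym sx) (trans (factor x≤n z≤n′ (sym e)) sz)) (λ e → m≢1+n+m (suc v) {0} e))

-- Every fold factors through the identity fold, whose endpoints are 0 and `n`.
boundary-endpoint : ∀ {n k q} → Fold n k q → ∀ {x} → x ≤ n → x ≡ 0 ⊎ x ≡ n → q x ≡ 0 ⊎ q x ≡ k
boundary-endpoint {q = q} F = endpoint-factor id-fold F (λ _ _ → cong q)

-- Round trips and traverses of a fold

module Phases {n a : ℕ} {q : ℕ → ℕ} (F : Fold n a q) (q0 : q 0 ≡ 0) (1≤a : 1 ≤ a) where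
  open Fold F

  -- `ℓ` counts the completed round trips between 0 and `a`. Quantifying over `g` lets one induction
  -- serve both `q` itself and every map that factors through it.
  record Ascended (ℓ x : ℕ) : Set where
    field
      total : ∀ g → variation (g ∘ q) x ≡ ℓ ℕ.* (2 ℕ.* variation g a) + variation g (q x)

  -- Here `ℓ` includes the round trip under way, whose missing part is added on the left to avoid
  -- subtraction.
  record Descended (ℓ x : ℕ) : Set where
    field
      total : ∀ g → variation (g ∘ q) x + variation g (q x) ≡ ℓ ℕ.* (2 ℕ.* variation g a)

  open Ascended
  open Descended

  -- The last component remembers where the walk came from: inside (0 , a) a fold cannot turn back.
  data Phase (x : ℕ) : Set where
    ascending  : ∀ ℓ → Ascended ℓ x →
      q x ≡ 0 ⊎ (∃ λ w → x ≡ suc w × q x ≡ suc (q w)) → Phase x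
    descending : ∀ ℓ → Descended ℓ x →
      q x ≡ a ⊎ (∃ λ w → x ≡ suc w × q w ≡ suc (q x)) → Phase x

  level-ascended : ∀ {ℓ x} → q x ≡ q (suc x) → Ascended ℓ x → Ascended ℓ (suc x)
  level-ascended {x = x} e as .total g rewrite sym e | ∣n-n∣≡0 (g (q x)) = as .total g

  level-descended : ∀ {ℓ x} → q x ≡ q (suc x) → Descended ℓ x → Descended ℓ (suc x)
  level-descended {x = x} e ds .total g rewrite sym e | ∣n-n∣≡0 (g (q x)) = ds .total g

  rise : ∀ {ℓ x} → q (suc x) ≡ suc (q x) → Ascended ℓ x → Ascended ℓ (suc x)
  rise {ℓ} {x} e as .total g rewrite e | as .total g =
    swap ∣ g (q x) - g (suc (q x)) ∣ (ℓ ℕ.* (2 ℕ.* variation g a)) (variation g (q x))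
    where
    swap : ∀ d e v → d + (e + v) ≡ e + (d + v)
    swap = solve-∀

  descend : ∀ {ℓ x} → q x ≡ suc (q (suc x)) → Descended ℓ x → Descended ℓ (suc x)
  descend {ℓ} {x} e ds .total g with ds .total g
  ... | eq rewrite e | ∣-∣-comm (g (suc (q (suc x)))) (g (q (suc x))) =
    trans (swap ∣ g (q (suc x)) - g (suc (q (suc x))) ∣ (variation (g ∘ q) x) (variation g (q (suc x)))) eq
    where
    swap : ∀ d e v → d + e + v ≡ e + (d + v)
    swap = solve-∀

  -- At value 0 the fold can only rest or rise. At an inner value `lift` yields a neighbour of `x`
  -- with value `suc (q x)`; the predecessor `w` has the value below `q x`, so it must be `suc x`.
  ascend-on : ∀ {ℓ x} → x < n → Ascended ℓ x →
    q x ≡ 0 ⊎ (∃ λ w → x ≡ suc w × q x ≡ suc (q w)) → q x ≢ a → Phase (suc x)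
  ascend-on {ℓ} {x} x<n as (inj₁ qx≡0) qx≢a with step x<n
  ... | inj₁ e        = ascending ℓ (level-ascended (sym e) as) (inj₁ (trans e qx≡0))
  ... | inj₂ (inj₁ e) = ascending ℓ (rise e as) (inj₂ (x , refl , e))
  ... | inj₂ (inj₂ e) = contradiction (trans (sym qx≡0) e) λ ()
  ascend-on {ℓ} {x} x<n as (inj₂ (w , refl , e)) qx≢a
    with lift (<⇒≤ x<n) (≤∧≢⇒< (bounded (<⇒≤ x<n)) qx≢a) (inj₂ (inj₁ refl))
  ... | y , _ , inj₁ refl , e′        = contradiction (sym e′) 1+n≢n
  ... | y , _ , inj₂ (inj₁ refl) , e′ = ascending ℓ (rise e′ as) (inj₂ (x , refl , e′))
  ... | y , _ , inj₂ (inj₂ refl) , e′ = contradiction (trans e′ (cong suc e)) (m≢1+n+m _ {1})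

  descend-on : ∀ {ℓ x} → x < n → Descended ℓ x →
    q x ≡ a ⊎ (∃ λ w → x ≡ suc w × q w ≡ suc (q x)) → q x ≢ 0 → Phase (suc x)
  descend-on {ℓ} {x} x<n ds (inj₁ qx≡a) qx≢0 with step x<n
  ... | inj₁ e        = descending ℓ (level-descended (sym e) ds) (inj₁ (trans e qx≡a))
  ... | inj₂ (inj₁ e) = contradiction (subst (_≤ a) (trans e (cong suc qx≡a)) (bounded x<n)) 1+n≰n
  ... | inj₂ (inj₂ e) = descending ℓ (descend e ds) (inj₂ (x , refl , e))
  descend-on {ℓ} {x} x<n ds (inj₂ (w , refl , e)) qx≢0 with ≢0⇒suc qx≢0
  ... | t , qx with lift (<⇒≤ x<n) (≤-trans (n≤1+n t) (subst (_≤ a) qx (bounded (<⇒≤ x<n)))) (inj₂ (inj₂ qx))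
  ... | y , _ , inj₁ refl , e′        = contradiction (trans (sym qx) e′) 1+n≢n
  ... | y , _ , inj₂ (inj₁ refl) , e′ =
    let e″ = trans qx (cong suc (sym e′)) in descending ℓ (descend e″ ds) (inj₂ (x , refl , e″))
  ... | y , _ , inj₂ (inj₂ refl) , e′ = contradiction (trans (sym e′) (trans e (cong suc qx))) (m≢1+n+m t {1})

  turn-down : ∀ {ℓ x} → q x ≡ a → Ascended ℓ x → Descended (suc ℓ) x
  turn-down {ℓ} e as .total g rewrite as .total g | e = double (ℓ ℕ.* (2 ℕ.* variation g a)) (variation g a)
    where
    double : ∀ e v → e + v + v ≡ 2 ℕ.* v + e
    double = solve-∀

  turn-up : ∀ {ℓ x} → q x ≡ 0 → Descended ℓ x → Ascended ℓ x
  turn-up e ds .total g with ds .total g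
  ... | eq rewrite e = trans (sym (+-identityʳ _)) (trans eq (sym (+-identityʳ _)))

  a≢0 : a ≢ 0
  a≢0 refl = contradiction 1≤a λ ()

  phase : ∀ {x} → x ≤ n → Phase x
  phase {zero}  _   = ascending 0 (record { total = λ g → cong (variation g) (sym q0) }) (inj₁ q0)
  phase {suc x} x<n with phase (<⇒≤ x<n) | q x ≟ a | q x ≟ 0
  ... | ascending  ℓ as from | no ≢a | _ = ascend-on x<n as from ≢a
  -- At an endpoint both readings of the position agree, so the walk changes direction before the
  -- next step.
  ... | ascending  ℓ as from | yes e | _ =
    descend-on x<n (turn-down e as) (inj₁ e) (λ e₀ → a≢0 (trans (sym e) e₀))
  ... | descending ℓ ds from | _ | no ≢0 = descend-on x<n ds from ≢0
  ... | descending ℓ ds from | _ | yes e =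
    ascend-on x<n (turn-up e ds) (inj₁ e) (λ eₐ → a≢0 (trans (sym eₐ) e))

  -- Modulo the length of a round trip, the two variations agree when ascending and are opposite
  -- when descending; divisibility ignores the sign.
  variation-∣ : ∀ g {d x} → d ∣ 2 ℕ.* variation g a → x ≤ n →
    (d ∣ variation (g ∘ q) x → d ∣ variation g (q x)) ×
    (d ∣ variation g (q x) → d ∣ variation (g ∘ q) x)
  variation-∣ g {d} {x} d∣ x≤n with phase x≤n
  ... | ascending ℓ as _ =
      (λ h → ∣m+n∣m⇒∣n (subst (d ∣_) (as .total g) h) (∣n⇒∣m*n ℓ d∣))
    , (λ h → subst (d ∣_) (sym (as .total g)) (∣m∣n⇒∣m+n (∣n⇒∣m*n ℓ d∣) h))
  ... | descending ℓ ds _ = ∣m+n∣m⇒∣n d∣sum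
    , ∣m+n∣m⇒∣n (subst (d ∣_) (+-comm (variation (g ∘ q) x) _) d∣sum)
    where
    d∣sum : d ∣ variation (g ∘ q) x + variation g (q x)
    d∣sum = subst (d ∣_) (sym (ds .total g)) (∣n⇒∣m*n ℓ d∣)

  position-∣ : ∀ {d x} → d ∣ 2 ℕ.* a → x ≤ n →
    (d ∣ variation q x → d ∣ q x) × (d ∣ q x → d ∣ variation q x)
  position-∣ {d} {x} d∣ x≤n
    with variation-∣ id (subst (λ v → d ∣ 2 ℕ.* v) (sym (variation-id a)) d∣) x≤n
  ... | to , from rewrite variation-id (q x) = to , from

  -- With `g = id` this shows that `f` is the frequency of `q`; the same `f` then applies to every
  -- other `g`.
  TraversedBy : ℕ → Set
  TraversedBy f = ∀ g → variation (g ∘ q) n ≡ f ℕ.* variation g a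

  even-traverses : ∀ {ℓ} → q n ≡ 0 → Ascended ℓ n → ∃ TraversedBy
  even-traverses {ℓ} e as = 2 ℕ.* ℓ , λ g →
    trans (as .total g) (trans (cong (λ t → _ + variation g t) e) (reassoc ℓ (variation g a)))
    where
    reassoc : ∀ l v → l ℕ.* (2 ℕ.* v) + 0 ≡ 2 ℕ.* l ℕ.* v
    reassoc = solve-∀

  odd-traverses : ∀ {ℓ} → q n ≡ a → Descended (suc ℓ) n → ∃ TraversedBy
  odd-traverses {ℓ} e ds = suc (2 ℕ.* ℓ) , λ g → +-cancelʳ-≡ (variation g a) _ _
    (trans (cong (λ t → _ + variation g t) (sym e)) (trans (ds .total g) (reassoc ℓ (variation g a))))
    where
    reassoc : ∀ l v → suc l ℕ.* (2 ℕ.* v) ≡ suc (2 ℕ.* l) ℕ.* v + v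
    reassoc = solve-∀

  -- Since `n` is sent to an endpoint, the last traverse is complete: there are `2ℓ` of them when
  -- the walk ends at 0, and an odd number when it ends at `a`.
  traverses : ∃ TraversedBy
  traverses with boundary-endpoint F ≤-refl (inj₂ refl) | phase ≤-refl
  ... | inj₁ e | ascending ℓ as _         = even-traverses e as
  ... | inj₁ e | descending ℓ ds _        = even-traverses e (turn-up e ds)
  ... | inj₂ e | ascending ℓ as _         = odd-traverses e (turn-down e as)
  ... | inj₂ e | descending (suc ℓ) ds _  = odd-traverses e ds
  -- With no round trip begun, the case `g = id` forces `q n ≡ 0`.
  ... | inj₂ e | descending zero ds _     = contradiction
    (trans (sym e) (trans (sym (variation-id (q n))) (m+n≡0⇒n≡0 (variation q n) (ds .total id)))) a≢0

-- A fold factored through a finer fold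

module Refinement {n a c : ℕ} {q s : ℕ → ℕ}
  (F : Fold n a q) (q0 : q 0 ≡ 0) (1≤a : 1 ≤ a)
  (J : Fold n c s) (s0 : s 0 ≡ 0) (1≤c : 1 ≤ c)
  (factor : ∀ {x y} → x ≤ n → y ≤ n → q x ≡ q y → s x ≡ s y) where

  private
    module F = Fold F
    module J = Fold J
    module PF = Phases F q0 1≤a
    module PJ = Phases J s0 1≤c

  -- The map with `s = p ∘ q`, read off at a chosen preimage; truncating at `a` makes it total.
  p : ℕ → ℕ
  p t = s (proj₁ (F.onto (m⊓n≤n t a)))

  p∘q : ∀ {x} → x ≤ n → p (q x) ≡ s x
  p∘q {x} x≤n = let y , y≤n , qy≡ = F.onto (m⊓n≤n (q x) a) in
    factor y≤n x≤n (trans qy≡ (m≤n⇒m⊓n≡m (F.bounded x≤n)))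

  variation-p∘q : ∀ {x} → x ≤ n → variation (p ∘ q) x ≡ variation s x
  variation-p∘q x≤n = variation-cong _ (λ y≤x → p∘q (≤-trans y≤x x≤n))

  -- The variation of s along one traverse of q.
  span : ℕ
  span = variation p a

  span-traverses : ∃ λ f → variation q n ≡ f ℕ.* a × variation s n ≡ f ℕ.* span
  span-traverses = let f , eq = PF.traverses in
    f , trans (eq id) (cong (f ℕ.*_) (variation-id a)) , trans (sym (variation-p∘q ≤-refl)) (eq p)

  -- By `variation-∣` for `p`, divisibility by `d` depends on the value of `q` alone.
  ∣-invariant : ∀ {d} → d ∣ 2 ℕ.* span → ∀ {x y} → x ≤ n → y ≤ n → q x ≡ q y →
    d ∣ variation s x → d ∣ variation s y
  ∣-invariant {d} d∣ x≤n y≤n e h =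
    subst (d ∣_) (variation-p∘q y≤n) (proj₂ (PF.variation-∣ p d∣ y≤n)
      (subst (λ t → d ∣ variation p t) e (proj₁ (PF.variation-∣ p d∣ x≤n)
        (subst (d ∣_) (sym (variation-p∘q x≤n)) h))))

  -- As `1 ≤ c`, the value `s x` has a different neighbour, which `s` lifts to a neighbour of `x`.
  -- At 0 and `a` only one `u` is possible, so `p` cannot rest in the first or last step of a
  -- traverse.
  p-moves : ∀ {x} → x ≤ n → ∃ λ u → u ≤ a × Near (q x) u × p u ≢ p (q x)
  p-moves {x} x≤n with neighbour (J.bounded x≤n)
    where
    neighbour : ∀ {v} → v ≤ c → ∃ λ u → u ≤ c × Near v u × u ≢ v
    neighbour {zero}  _   = 1 , 1≤c , inj₂ (inj₁ refl) , λ ()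
    neighbour {suc v} v<c = v , <⇒≤ v<c , inj₂ (inj₂ refl) , λ e → 1+n≢n (sym e)
  ... | u , u≤c , near , u≢ with J.lift x≤n u≤c near
  ... | y , y≤n , x~y , refl =
    q y , F.bounded y≤n , F.near x≤n y≤n x~y , λ e → u≢ (trans (sym (p∘q y≤n)) (trans e (p∘q x≤n)))

  p0≢p1 : p 0 ≢ p 1
  p0≢p1 e with p-moves z≤n
  ... | u , _ , near , pu≢ rewrite q0 with near
  ...   | inj₁ refl        = pu≢ refl
  ...   | inj₂ (inj₁ refl) = pu≢ (sym e)

  p[a-1]≢pa : ∀ {b} → a ≡ suc b → p b ≢ p a
  p[a-1]≢pa refl e with F.onto ≤-refl
  ... | x , x≤n , qx≡a with p-moves x≤n
  ... | u , u≤a , near , pu≢ rewrite qx≡a with near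
  ...   | inj₁ refl        = pu≢ refl
  ...   | inj₂ (inj₁ refl) = 1+n≰n u≤a
  ...   | inj₂ (inj₂ refl) = pu≢ e

  variation-p-positive : ∀ {t} → 1 ≤ t → 0 < variation p t
  variation-p-positive 1≤t = ≤-trans (variation-suc-< p 0 p0≢p1) (variation-mono p 1≤t)

  variation-p-<-span : ∀ {t} → t < a → variation p t < span
  variation-p-<-span t<a with ≢0⇒suc PF.a≢0
  ... | b , refl = ≤-<-trans (variation-mono p (ℕ.s≤s⁻¹ t<a)) (variation-suc-< p b (p[a-1]≢pa refl))

  -- Since `p` moves in its first and last steps, its variation up to an inner value lies strictly
  -- between 0 and `span`, hence is no multiple of `span`.
  span-∣⇒endpoint : ∀ {x} → x ≤ n → span ∣ variation s x → q x ≡ 0 ⊎ q x ≡ a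
  span-∣⇒endpoint {x} x≤n h with q x ≟ 0 | q x ≟ a
  ... | yes e | _     = inj₁ e
  ... | no _  | yes e = inj₂ e
  ... | no ≢0 | no ≢a = contradiction
    (proj₁ (PF.variation-∣ p (n∣m*n 2) x≤n) (subst (span ∣_) (sym (variation-p∘q x≤n)) h))
    (>⇒∤ {{>-nonZero (variation-p-positive (n≢0⇒n>0 ≢0))}}
      (variation-p-<-span (≤∧≢⇒< (F.bounded x≤n) ≢a)))

  c≤variation : c ≤ variation s n
  c≤variation = let x , x≤n , sx≡c = J.onto ≤-refl in
    ≤-trans (subst₂ (λ u v → ∣ u - v ∣ ≤ variation s x) s0 sx≡c (∣-∣≤variation s x)) (variation-mono s x≤n)

  span-∣ : span ∣ variation s n
  span-∣ = let f , _ , eq = span-traverses in divides f eq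

  -- The point reached after `span` moves of `s` is an endpoint for `q`, hence for `s`; its position
  -- 0 or `c` is divisible by `c`, and so is its number of moves.
  step-∣-span : c ∣ span
  step-∣-span with J.variation-attains (∣⇒≤ {{>-nonZero (≤-trans 1≤c c≤variation)}} span-∣)
  ... | x , x≤n , e = subst (c ∣_) e (proj₂ (PJ.position-∣ (n∣m*n 2) x≤n) (c∣
    (endpoint-factor F J factor x≤n (span-∣⇒endpoint x≤n (∣-reflexive (sym e))))))
    where
    c∣ : s x ≡ 0 ⊎ s x ≡ c → c ∣ s x
    c∣ (inj₁ sx≡0) = subst (c ∣_) (sym sx≡0) (c ∣0)
    c∣ (inj₂ sx≡c) = ∣-reflexive (sym sx≡c)

-- Counting rests

-- Here `h x` counts the image points below `x`. Ranking image points by `h`, and recovering from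
-- each rank the jump that `climb` provides, gives injections both ways.
injective-image-size : ∀ {n r} (h : ℕ → ℕ) (g : Fin r → Fin n) → Injective _≡_ _≡_ g →
  h 0 ≡ 0 →
  (∀ i → (h (suc (toℕ i)) ≡ suc (h (toℕ i)) × ∃ λ j → g j ≡ i) ⊎
         (h (suc (toℕ i)) ≡ h (toℕ i) × ¬ ∃ λ j → g j ≡ i)) →
  r ≡ h n
injective-image-size {n} {r} h g g-inj h0 jumps =
  ≤-antisym (injective⇒≤ {f = rank} rank-inj) (injective⇒≤ {f = unrank} unrank-inj)
  where
  jumps-at : ∀ j → h (suc (toℕ (g j))) ≡ suc (h (toℕ (g j)))
  jumps-at j with jumps (g j)
  ... | inj₁ (e , _) = e
  ... | inj₂ (_ , ∄) = contradiction (j , refl) ∄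

  h-suc : ∀ {x} → x < n → h x ≤ h (suc x) × h (suc x) ≤ suc (h x)
  h-suc x<n with jumps (fromℕ< x<n)
  ... | j rewrite toℕ-fromℕ< x<n with j
  ... | inj₁ (e , _) = ≤-trans (n≤1+n _) (≤-reflexive (sym e)) , ≤-reflexive e
  ... | inj₂ (e , _) = ≤-reflexive (sym e) , m≤n⇒m≤1+n (≤-reflexive e)

  h-mono : ∀ {x y} → x ≤ y → y ≤ n → h x ≤ h y
  h-mono x≤y y≤n with m≤n⇒m<n∨m≡n x≤y
  ... | inj₂ refl = ≤-refl
  h-mono {y = suc y} x≤y y<n | inj₁ (s≤s x≤y′) =
    ≤-trans (h-mono x≤y′ (<⇒≤ y<n)) (proj₁ (h-suc y<n))

  h-< : ∀ j {y} → toℕ (g j) < y → y ≤ n → h (toℕ (g j)) < h y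
  h-< j lt y≤n = ≤-trans (≤-reflexive (sym (jumps-at j))) (h-mono lt y≤n)

  rank : Fin r → Fin (h n)
  rank j = fromℕ< (h-< j (toℕ<n (g j)) ≤-refl)

  rank-inj : Injective _≡_ _≡_ rank
  rank-inj {i} {j} e = g-inj (toℕ-injective (≤-antisym
    (≮⇒≥ (λ lt → <-irrefl (sym same) (h-< j lt (<⇒≤ (toℕ<n (g i))))))
    (≮⇒≥ (λ lt → <-irrefl same (h-< i lt (<⇒≤ (toℕ<n (g j))))))))
    where
    same : h (toℕ (g i)) ≡ h (toℕ (g j))
    same = trans (sym (toℕ-fromℕ< _)) (trans (cong toℕ e) (toℕ-fromℕ< _))

  preimage : ∀ (v : Fin (h n)) → ∃ λ j → h (toℕ (g j)) ≡ toℕ v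
  preimage v with climb h n h0 (λ x<n → proj₂ (h-suc x<n)) (toℕ<n v)
  ... | x , x<n , e , e′ with jumps (fromℕ< x<n) | toℕ-fromℕ< x<n
  ... | inj₁ (_ , j , gj≡) | toℕ≡ = j , trans (cong (h ∘ toℕ) gj≡) (trans (cong h toℕ≡) e)
  ... | inj₂ (flat , _)    | toℕ≡ = contradiction
    (trans (sym e′) (trans (subst (λ y → h (suc y) ≡ h y) toℕ≡ flat) e)) 1+n≢n

  unrank : Fin (h n) → Fin r
  unrank v = proj₁ (preimage v)

  unrank-inj : Injective _≡_ _≡_ unrank
  unrank-inj {u} {v} e = toℕ-injective
    (trans (sym (proj₂ (preimage u))) (trans (cong (h ∘ toℕ ∘ g) e) (proj₂ (preimage v))))

-- The truncated difference is 1 at a rest and 0 at any change of value, so this counts rests.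
pauses : (ℕ → ℕ) → ℕ → ℕ
pauses f zero    = 0
pauses f (suc x) = (1 ∸ ∣ f x - f (suc x) ∣) + pauses f x

pauses+variation : ∀ {n k q} → Fold n k q → ∀ {x} → x ≤ n → pauses q x + variation q x ≡ x
pauses+variation F {zero} _ = refl
pauses+variation {q = q} F {suc x} x<n = begin
  (1 ∸ d) + pauses q x + (d + variation q x)   ≡⟨ shuffle (1 ∸ d) (pauses q x) d (variation q x) ⟩
  (1 ∸ d) + d + (pauses q x + variation q x)   ≡⟨ cong₂ _+_ (m∸n+n≡m (near⇒∣-∣≤1 (step x<n))) (pauses+variation F (<⇒≤ x<n)) ⟩
  suc x                                        ∎
  where
  open Fold F
  open ≡-Reasoning
  d = ∣ q x - q (suc x) ∣
  shuffle : ∀ a b c d → a + b + (c + d) ≡ a + c + (b + d)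
  shuffle = solve-∀

-- From congruences to folds

Back : (n : ℕ) → Rel (Pt n) 0ℓ → Set
Back n θ = ∀ x′ x y → θ x′ x → L n x y → ∃ λ y′ → L n x′ y′ × θ y′ y

-- Induction on the derivation of the join, in both directions at once because `Join.sym` exchanges
-- them.
join-back : ∀ {n θ δ} → IsCongruence n θ → IsCongruence n δ → Back n (Join θ δ)
join-back {n} {θ} {δ} Cθ Cδ x′ x y j = proj₁ (both j) y
  where
  module θ = IsCongruence Cθ
  module δ = IsCongruence Cδ
  Transfers : Pt n → Pt n → Set
  Transfers x′ x = ∀ y → L n x y → ∃ λ y′ → L n x′ y′ × Join θ δ y′ y
  both : ∀ {x′ x} → Join θ δ x′ x → Transfers x′ x × Transfers x x′
  both (inl t) =
      (λ y l → let y′ , l′ , t′ = θ.back _ _ y t l in y′ , l′ , inl t′)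
    , (λ y l → let y′ , l′ , t′ = θ.back _ _ y (IsEquivalence.sym θ.isEquivalence t) l in y′ , l′ , inl t′)
  both (inr t) =
      (λ y l → let y′ , l′ , t′ = δ.back _ _ y t l in y′ , l′ , inr t′)
    , (λ y l → let y′ , l′ , t′ = δ.back _ _ y (IsEquivalence.sym δ.isEquivalence t) l in y′ , l′ , inr t′)
  both Join.refl = (λ y l → y , l , Join.refl) , (λ y l → y , l , Join.refl)
  both (Join.sym j) = let f , b = both j in b , f
  both (Join.trans j k) =
      (λ y l → let y₁ , l₁ , j₁ = f₂ y l ; y₂ , l₂ , j₂ = f₁ y₁ l₁ in y₂ , l₂ , Join.trans j₂ j₁)
    , (λ y l → let y₁ , l₁ , j₁ = b₁ y l ; y₂ , l₂ , j₂ = b₂ y₁ l₁ in y₂ , l₂ , Join.trans j₂ j₁)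
    where
    f₁ = proj₁ (both j)
    b₁ = proj₂ (both j)
    f₂ = proj₁ (both k)
    b₂ = proj₂ (both k)

-- Turns round a quotient map that sends 0 to the top endpoint, so that every walk starts at 0.
reflect : ℕ → (ℕ → ℕ) → ℕ → ℕ
reflect k q x = k ∸ q x

reflect-fold : ∀ {n k q} → Fold n k q → Fold n k (reflect k q)
reflect-fold {n} {k} {q} F = record
  { bounded = λ {x} _ → m∸n≤m k (q x)
  ; step    = λ x<n → near-∸ (bounded (<⇒≤ x<n)) (bounded x<n) (step x<n)
  ; lift    = λ {x} {u} x≤n u≤k near →
      let y , y≤n , x~y , e = lift x≤n (m∸n≤m k u)
            (subst (λ t → Near t (k ∸ u)) (m∸[m∸n]≡n (bounded x≤n)) (near-∸ (m∸n≤m k (q x)) u≤k near))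
      in y , y≤n , x~y , trans (cong (k ∸_) e) (m∸[m∸n]≡n u≤k)
  ; onto    = λ {t} t≤k → let x , x≤n , e = onto (m∸n≤m k t) in x , x≤n , trans (cong (k ∸_) e) (m∸[m∸n]≡n t≤k)
  }
  where open Fold F

record Folded (n : ℕ) (θ : Rel (Pt n) 0ℓ) (k : ℕ) : Set where
  field
    map      : ℕ → ℕ
    fold     : Fold n k map
    start    : map 0 ≡ 0
    kernel   : ∀ x y → θ x y ⇔ map (toℕ x) ≡ map (toℕ y)
    extreme  : ∀ x → map (toℕ x) ≡ 0 ⊎ map (toℕ x) ≡ k → Extreme n θ x

  open Fold fold public

  -- Each of the `n` steps is a rest or a move, and `r` is the number of pauses.
  rests : ∀ {r} → Rests n θ r → n ∸ r ≡ variation map n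
  rests {r} (g , g-inj , g-image) = trans (cong₂ _∸_ (sym (pauses+variation fold ≤-refl)) r≡)
    (m+n∸m≡n (pauses map n) (variation map n))
    where
    rest : ∀ i → map (toℕ i) ≡ map (suc (toℕ i)) ⇔ ∃ λ j → g j ≡ i
    rest i = mk⇔
      (λ e → to (g-image i) (from (kernel _ _) (trans (cong map (toℕ-inject₁ i)) e)))
      (λ ∃j → trans (cong map (sym (toℕ-inject₁ i))) (to (kernel _ _) (from (g-image i) ∃j)))
    r≡ : r ≡ pauses map n
    r≡ = injective-image-size (pauses map) g g-inj refl jumps
      where
      jumps : ∀ i → (pauses map (suc (toℕ i)) ≡ suc (pauses map (toℕ i)) × ∃ λ j → g j ≡ i) ⊎
                    (pauses map (suc (toℕ i)) ≡ pauses map (toℕ i) × ¬ ∃ λ j → g j ≡ i)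
      jumps i with map (toℕ i) ≟ map (suc (toℕ i))
      ... | yes e = inj₁ (cong (λ d → (1 ∸ d) + pauses map (toℕ i)) (m≡n⇒∣m-n∣≡0 e) , to (rest i) e)
      ... | no ≢  = inj₂ (cong (_+ pauses map (toℕ i)) (m≤n⇒m∸n≡0 (n≢0⇒n>0 (≢ ∘ ∣m-n∣≡0⇒m≡n))) , ≢ ∘ from (rest i))

module FromQuotient {n k : ℕ} {θ : Rel (Pt n) 0ℓ} (back : Back n θ)
  {q : Pt n → Pt k} (Q : QuotientLine n θ k q) where

  open QuotientLine Q

  at : ℕ → Pt n
  at x = fromℕ< (s≤s (m⊓n≤n x n))

  toℕ-at : ∀ {x} → x ≤ n → toℕ (at x) ≡ x
  toℕ-at x≤n = trans (toℕ-fromℕ< _) (m≤n⇒m⊓n≡m x≤n)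

  at-toℕ : ∀ x → at (toℕ x) ≡ x
  at-toℕ x = toℕ-injective (toℕ-at (toℕ≤pred[n] x))

  q̂ : ℕ → ℕ
  q̂ x = toℕ (q (at x))

  q̂-toℕ : ∀ x → q̂ (toℕ x) ≡ toℕ (q x)
  q̂-toℕ x = cong (toℕ ∘ q) (at-toℕ x)

  q̂-fold : Fold n k q̂
  q̂-fold = record
    { bounded = λ {x} _ → toℕ≤pred[n] (q (at x))
    ; step    = λ {x} x<n → ∣-∣≤1⇒near _ _ (from (hom (at x) (at (suc x)))
        (_ , _ , θ-refl , θ-refl , subst₂ (λ u v → ∣ u - v ∣ ≤ 1)
          (sym (toℕ-at (<⇒≤ x<n))) (sym (toℕ-at x<n)) (≤-reflexive (∣n-1+n∣≡1 x))))
    ; lift    = lift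
    ; onto    = λ {t} t≤k → let x , e = surjective (fromℕ< (s≤s t≤k)) in
        toℕ x , toℕ≤pred[n] x , trans (q̂-toℕ x) (trans (cong toℕ (e refl)) (toℕ-fromℕ< (s≤s t≤k)))
    }
    where
    θ-refl : ∀ {x} → θ x x
    θ-refl = from (kernel _ _) refl

    lift : ∀ {x u} → x ≤ n → u ≤ k → Near (q̂ x) u → ∃ λ y → y ≤ n × Near x y × q̂ y ≡ u
    lift {x} {u} x≤n u≤k near with surjective (fromℕ< (s≤s u≤k))
    ... | z , qz≡ with to (hom (at x) z) (subst (λ v → ∣ q̂ x - v ∣ ≤ 1)
                        (sym (trans (cong toℕ (qz≡ refl)) (toℕ-fromℕ< (s≤s u≤k)))) (near⇒∣-∣≤1 near))
    -- `hom` only relates some members of the two classes; the back condition moves the relation to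
    -- `x` itself.
    ... | x′ , z′ , xθx′ , zθz′ , x′~z′ with back (at x) x′ z′ xθx′ x′~z′
    ... | y , x~y , yθz′ = toℕ y , toℕ≤pred[n] y
      , subst (λ v → Near v (toℕ y)) (toℕ-at x≤n) (∣-∣≤1⇒near _ _ x~y)
      , trans (q̂-toℕ y) (trans (cong toℕ (trans (to (kernel _ _) yθz′)
          (trans (sym (to (kernel _ _) zθz′)) (qz≡ refl)))) (toℕ-fromℕ< (s≤s u≤k)))

  q̂-kernel : ∀ x y → θ x y ⇔ q̂ (toℕ x) ≡ q̂ (toℕ y)
  q̂-kernel x y = mk⇔
    (λ xθy → trans (q̂-toℕ x) (trans (cong toℕ (to (kernel x y) xθy)) (sym (q̂-toℕ y))))
    (λ e → from (kernel x y) (toℕ-injective (trans (sym (q̂-toℕ x)) (trans e (q̂-toℕ y)))))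

  q̂-extreme : ∀ x → q̂ (toℕ x) ≡ 0 ⊎ q̂ (toℕ x) ≡ k → Extreme n θ x
  q̂-extreme x (inj₁ e) = k , q , Q , inj₁ (toℕ-injective (trans (sym (q̂-toℕ x)) e))
  q̂-extreme x (inj₂ e) = k , q , Q , inj₂ (toℕ-injective (trans (sym (q̂-toℕ x)) (trans e (sym (toℕ-fromℕ k)))))

  q̂-bounded : ∀ x → q̂ x ≤ k
  q̂-bounded x = toℕ≤pred[n] (q (at x))

  folded : Folded n θ k
  folded with boundary-endpoint q̂-fold z≤n (inj₁ refl)
  ... | inj₁ e = record
    { map = q̂ ; fold = q̂-fold ; start = e ; kernel = q̂-kernel ; extreme = q̂-extreme }
  ... | inj₂ e = record
    { map     = reflect k q̂
    ; fold    = reflect-fold q̂-fold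
    ; start   = trans (cong (k ∸_) e) (n∸n≡0 k)
    ; kernel  = λ x y → mk⇔ (cong (k ∸_) ∘ to (q̂-kernel x y))
        (from (q̂-kernel x y) ∘ ∸-cancelˡ-≡ (q̂-bounded (toℕ x)) (q̂-bounded (toℕ y)))
    ; extreme = λ x → q̂-extreme x ∘ unreflect x
    }
    where
    unreflect : ∀ x → k ∸ q̂ (toℕ x) ≡ 0 ⊎ k ∸ q̂ (toℕ x) ≡ k → q̂ (toℕ x) ≡ 0 ⊎ q̂ (toℕ x) ≡ k
    unreflect x (inj₁ e) = inj₂ (≤-antisym (q̂-bounded (toℕ x)) (m∸n≡0⇒m≤n e))
    unreflect x (inj₂ e) = inj₁ (trans (sym (m∸[m∸n]≡n (q̂-bounded (toℕ x)))) (trans (cong (k ∸_) e) (n∸n≡0 k)))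

-- Frequencies as rational numbers

-- `_/_` reduces to lowest terms, so the comparison passes to unnormalised rationals, where equality
-- is cross multiplication.
/-*-cong : ∀ A a B b C c → C ℕ.* (suc a ℕ.* suc b) ≡ A ℕ.* B ℕ.* suc c →
  (ℤ.+ C) / suc c ≡ (ℤ.+ A) / suc a * ((ℤ.+ B) / suc b)
/-*-cong A a B b C c e = toℚᵘ-injective (begin
  toℚᵘ ((ℤ.+ C) / suc c)                                    ≈⟨ toℚᵘ-fromℚᵘ (mkℚᵘ (ℤ.+ C) c) ⟩
  mkℚᵘ (ℤ.+ C) c                                            ≈⟨ *≡* cross ⟩
  mkℚᵘ (ℤ.+ A) a ℚᵘ.* mkℚᵘ (ℤ.+ B) b                        ≈⟨ ℚᵘₚ.*-cong (toℚᵘ-fromℚᵘ (mkℚᵘ (ℤ.+ A) a)) (toℚᵘ-fromℚᵘ (mkℚᵘ (ℤ.+ B) b)) ⟨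
  toℚᵘ ((ℤ.+ A) / suc a) ℚᵘ.* toℚᵘ ((ℤ.+ B) / suc b)        ≈⟨ toℚᵘ-homo-* ((ℤ.+ A) / suc a) ((ℤ.+ B) / suc b) ⟨
  toℚᵘ ((ℤ.+ A) / suc a * ((ℤ.+ B) / suc b))                ∎)
  where
  open ℚᵘₚ.≃-Reasoning
  cross : ℤ.+ C ℤ.* ℤ.+ (suc a ℕ.* suc b) ≡ (ℤ.+ A ℤ.* ℤ.+ B) ℤ.* ℤ.+ suc c
  cross = trans (sym (ℤₚ.pos-* C _)) (trans (cong ℤ.+_ e)
    (trans (ℤₚ.pos-* (A ℕ.* B) _) (cong (ℤ._* ℤ.+ suc c) (ℤₚ.pos-* A B))))

freq-* : ∀ {n rθ rδ rj kθ kδ kj} → 1 ≤ kθ → 1 ≤ kδ → 1 ≤ kj →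
  (n ∸ rj) ℕ.* (kθ ℕ.* kδ) ≡ (n ∸ rθ) ℕ.* (n ∸ rδ) ℕ.* kj →
  freq n rj kj ≡ freq n rθ kθ * freq n rδ kδ
freq-* {n} {rθ} {rδ} {rj} {suc a} {suc b} {suc c} _ _ _ = /-*-cong (n ∸ rθ) a (n ∸ rδ) b (n ∸ rj) c

-- Move counts for the join of two congruences

∣⇒≡⊎2*≤ : ∀ {c C} → 0 < C → c ∣ C → c ≡ C ⊎ 2 ℕ.* c ≤ C
∣⇒≡⊎2*≤     0<C (divides zero          refl) = contradiction 0<C λ ()
∣⇒≡⊎2*≤ {c} _   (divides (suc zero)    refl) = inj₁ (sym (+-identityʳ c))
∣⇒≡⊎2*≤ {c} _   (divides (suc (suc k)) refl) = inj₂ (*-monoˡ-≤ c {2} {suc (suc k)} (s≤s (s≤s z≤n)))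

module Frequencies {n a b c : ℕ} {θ δ : Rel (Pt n) 0ℓ}
  (Θ : Folded n θ a) (Δ : Folded n δ b) (J : Folded n (Join θ δ) c)
  (1≤a : 1 ≤ a) (1≤b : 1 ≤ b) (1≤c : 1 ≤ c)
  (common-extreme : ∀ x → Extreme n θ x × Extreme n δ x → x ≡ fzero ⊎ x ≡ fromℕ n) where

  private
    module Θ = Folded Θ
    module Δ = Folded Δ
    module J = Folded J

  factor : ∀ {η k} (H : Folded n η k) → (∀ {x y} → η x y → Join θ δ x y) →
    ∀ {x y} → x ≤ n → y ≤ n → Folded.map H x ≡ Folded.map H y → J.map x ≡ J.map y
  factor H η⊆ x≤n y≤n e with to (J.kernel _ _) (η⊆ (from (Folded.kernel H (fromℕ< (s≤s x≤n)) (fromℕ< (s≤s y≤n)))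
    (subst₂ (λ u v → Folded.map H u ≡ Folded.map H v) (sym (toℕ-fromℕ< (s≤s x≤n))) (sym (toℕ-fromℕ< (s≤s y≤n))) e)))
  ... | e′ = subst₂ (λ u v → J.map u ≡ J.map v) (toℕ-fromℕ< (s≤s x≤n)) (toℕ-fromℕ< (s≤s y≤n)) e′

  module Rθ = Refinement Θ.fold Θ.start 1≤a J.fold J.start 1≤c (factor Θ inl)
  module Rδ = Refinement Δ.fold Δ.start 1≤b J.fold J.start 1≤c (factor Δ inr)

  D E C g : ℕ
  D = Rθ.span
  E = Rδ.span
  C = variation J.map n
  g = gcd D E

  0<C : 0 < C
  0<C = ≤-trans 1≤c Rθ.c≤variation

  -- The point reached after `lcm D E` moves is an extreme of both congruences, so it is 0 or `n`.
  -- The point 0 would make the lcm 0, which does not divide the positive `C`.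
  lcm≡C : lcm D E ≡ C
  lcm≡C with J.variation-attains (∣⇒≤ {{>-nonZero 0<C}} (lcm-least Rθ.span-∣ Rδ.span-∣))
  ... | x , x≤n , e with common-extreme (fromℕ< (s≤s x≤n))
      ( Θ.extreme _ (subst (λ y → Θ.map y ≡ 0 ⊎ Θ.map y ≡ a) (sym x≡)
          (Rθ.span-∣⇒endpoint x≤n (subst (D ∣_) (sym e) (m∣lcm[m,n] D E))))
      , Δ.extreme _ (subst (λ y → Δ.map y ≡ 0 ⊎ Δ.map y ≡ b) (sym x≡)
          (Rδ.span-∣⇒endpoint x≤n (subst (E ∣_) (sym e) (n∣lcm[m,n] D E)))))
    where
    x≡ : toℕ (fromℕ< (s≤s x≤n)) ≡ x
    x≡ = toℕ-fromℕ< (s≤s x≤n)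
  ... | inj₂ x≡n = trans (sym e) (cong (variation J.map)
    (trans (sym (toℕ-fromℕ< (s≤s x≤n))) (trans (cong toℕ x≡n) (toℕ-fromℕ n))))
  ... | inj₁ x≡0 = contradiction (0∣⇒≡0 (subst (_∣ C) lcm≡0 (lcm-least Rθ.span-∣ Rδ.span-∣))) (>⇒≢ 0<C)
    where
    lcm≡0 : lcm D E ≡ 0
    lcm≡0 = trans (sym e) (cong (variation J.map)
      (trans (sym (toℕ-fromℕ< (s≤s x≤n))) (cong toℕ x≡0)))

  -- `2g` divides both `2D` and `2E`, so `∣-invariant` settles the generating pairs of the join.
  2g-invariant : ∀ {x y} → Join θ δ x y →
    (2 ℕ.* g ∣ variation J.map (toℕ x) → 2 ℕ.* g ∣ variation J.map (toℕ y)) ×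
    (2 ℕ.* g ∣ variation J.map (toℕ y) → 2 ℕ.* g ∣ variation J.map (toℕ x))
  2g-invariant {x} {y} (inl t) = Rθ.∣-invariant g∣ x≤n y≤n e , Rθ.∣-invariant g∣ y≤n x≤n (sym e)
    where
    g∣  = *-monoʳ-∣ 2 (gcd[m,n]∣m D E)
    x≤n = toℕ≤pred[n] x
    y≤n = toℕ≤pred[n] y
    e   = to (Θ.kernel x y) t
  2g-invariant {x} {y} (inr t) = Rδ.∣-invariant g∣ x≤n y≤n e , Rδ.∣-invariant g∣ y≤n x≤n (sym e)
    where
    g∣  = *-monoʳ-∣ 2 (gcd[m,n]∣n D E)
    x≤n = toℕ≤pred[n] x
    y≤n = toℕ≤pred[n] y
    e   = to (Δ.kernel x y) t
  2g-invariant Join.refl        = id , id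
  2g-invariant (Join.sym j)     = let f , b = 2g-invariant j in b , f
  2g-invariant (Join.trans i j) =
    let f₁ , b₁ = 2g-invariant i ; f₂ , b₂ = 2g-invariant j in f₂ ∘ f₁ , b₁ ∘ b₂

  -- After two traverses the walk is back in the class of 0, so 2c is subject to the invariant.
  2c≤C⇒g∣c : 2 ℕ.* c ≤ C → g ∣ c
  2c≤C⇒g∣c 2c≤C with J.variation-attains 2c≤C
  ... | x , x≤n , e = *-cancelˡ-∣ 2 (subst (2 ℕ.* g ∣_) (trans (cong (variation J.map) x≡) e)
      (proj₁ (2g-invariant (from (J.kernel fzero (fromℕ< (s≤s x≤n)))
        (trans J.start (sym (trans (cong J.map x≡) Jx≡0))))) (_ ∣0)))
    where
    x≡ : toℕ (fromℕ< (s≤s x≤n)) ≡ x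
    x≡ = toℕ-fromℕ< (s≤s x≤n)
    -- After `2c` moves the position is a multiple of `2c`; being at most `c`, it is 0.
    2c∣Jx : 2 ℕ.* c ∣ J.map x
    2c∣Jx = proj₁ (Phases.position-∣ J.fold J.start 1≤c ∣-refl x≤n) (∣-reflexive (sym e))
    Jx≡0 : J.map x ≡ 0
    Jx≡0 with J.map x | 2c∣Jx | J.bounded x≤n
    ... | zero  | _ | _    = refl
    ... | suc v | d | v<c = contradiction (≤-trans (+-mono-≤ 1≤c (m≤m+n c 0)) (≤-trans (∣⇒≤ d) v<c)) 1+n≰n

  g≡c : g ≡ c
  g≡c = ∣-antisym g∣c (gcd-greatest Rθ.step-∣-span Rδ.step-∣-span)
    where
    g∣c : g ∣ c
    g∣c with ∣⇒≡⊎2*≤ 0<C (∣-trans Rθ.step-∣-span Rθ.span-∣)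
    -- A single traverse leaves no point after `2c` moves, but then `g` divides `D`, which divides
    -- `C = c`.
    ... | inj₁ c≡C  = subst (g ∣_) (sym c≡C) (∣-trans (gcd[m,n]∣m D E) Rθ.span-∣)
    ... | inj₂ 2c≤C = 2c≤C⇒g∣c 2c≤C

  -- After multiplication by `C`, one factor `C` is written as `f D` and the other as `f′ E`; the
  -- product `D E` is gcd times lcm, that is `c C`.
  variation-* : C ℕ.* (a ℕ.* b) ≡ variation Θ.map n ℕ.* variation Δ.map n ℕ.* c
  variation-* with Rθ.span-traverses | Rδ.span-traverses
  ... | f , A≡ , C≡fD | f′ , B≡ , C≡f′E = *-cancelʳ-≡ _ _ C {{>-nonZero 0<C}} (begin
    C ℕ.* (a ℕ.* b) ℕ.* C                            ≡⟨ square C a b ⟩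
    C ℕ.* C ℕ.* (a ℕ.* b)                            ≡⟨ cong₂ (λ u v → u ℕ.* v ℕ.* (a ℕ.* b)) C≡fD C≡f′E ⟩
    f ℕ.* D ℕ.* (f′ ℕ.* E) ℕ.* (a ℕ.* b)             ≡⟨ regroup f D f′ E a b ⟩
    f ℕ.* a ℕ.* (f′ ℕ.* b) ℕ.* (D ℕ.* E)             ≡⟨ cong₂ ℕ._*_ (cong₂ ℕ._*_ A≡ B≡) (trans (cong₂ ℕ._*_ (sym g≡c) (sym lcm≡C)) (gcd*lcm D E)) ⟨
    A ℕ.* B ℕ.* (c ℕ.* C)                            ≡⟨ *-assoc (A ℕ.* B) c C ⟨
    A ℕ.* B ℕ.* c ℕ.* C                              ∎)
    where
    open ≡-Reasoning
    A = variation Θ.map n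
    B = variation Δ.map n
    square : ∀ C a b → C ℕ.* (a ℕ.* b) ℕ.* C ≡ C ℕ.* C ℕ.* (a ℕ.* b)
    square = solve-∀
    regroup : ∀ f D f′ E a b → f ℕ.* D ℕ.* (f′ ℕ.* E) ℕ.* (a ℕ.* b) ≡ f ℕ.* a ℕ.* (f′ ℕ.* b) ℕ.* (D ℕ.* E)
    regroup = solve-∀

theorem5p11 : (n : ℕ) → 1 ≤ n → (θ δ : Rel (Pt n) 0ℓ) →
    IsCongruence n θ → IsCongruence n δ →
    (kθ kδ kj : ℕ) → Step n θ kθ → Step n δ kδ → Step n (Join θ δ) kj →
    1 ≤ kθ → 1 ≤ kδ →
    ¬ (∀ x y → Join θ δ x y) →
    (∀ e → (Extreme n θ e × Extreme n δ e) ⇔ (e ≡ fzero ⊎ e ≡ fromℕ n)) →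
    (rθ rδ rj : ℕ) → Rests n θ rθ → Rests n δ rδ → Rests n (Join θ δ) rj →
    freq n rj kj ≡ freq n rθ kθ * freq n rδ kδ
theorem5p11 n _ θ δ Cθ Cδ kθ kδ kj (_ , Qθ) (_ , Qδ) (_ , Qj) 1≤kθ 1≤kδ ¬total common rθ rδ rj Rθ Rδ Rj =
  freq-* {n} {rθ} {rδ} {rj} 1≤kθ 1≤kδ 1≤kj (begin
    (n ∸ rj) ℕ.* (kθ ℕ.* kδ)            ≡⟨ cong (ℕ._* (kθ ℕ.* kδ)) (Folded.rests J Rj) ⟩
    variation J.map n ℕ.* (kθ ℕ.* kδ)   ≡⟨ Frequencies.variation-* Θ Δ J 1≤kθ 1≤kδ 1≤kj (λ x → to (common x)) ⟩
    variation Θ.map n ℕ.* variation Δ.map n ℕ.* kj ≡⟨ cong (ℕ._* kj) (cong₂ ℕ._*_ (Θ.rests Rθ) (Δ.rests Rδ)) ⟨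
    (n ∸ rθ) ℕ.* (n ∸ rδ) ℕ.* kj        ∎)
  where
  open ≡-Reasoning
  Θ = FromQuotient.folded (IsCongruence.back Cθ) Qθ
  Δ = FromQuotient.folded (IsCongruence.back Cδ) Qδ
  J = FromQuotient.folded (join-back Cθ Cδ) Qj
  module Θ = Folded Θ
  module Δ = Folded Δ
  module J = Folded J
  total-if-one-class : kj ≡ 0 → ∀ x y → Join θ δ x y
  total-if-one-class refl x y = from (J.kernel x y)
    (trans (n≤0⇒n≡0 (J.bounded (toℕ≤pred[n] x))) (sym (n≤0⇒n≡0 (J.bounded (toℕ≤pred[n] y)))))
  1≤kj : 1 ≤ kj
  1≤kj = n≢0⇒n>0 (¬total ∘ total-if-one-class)
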